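{- Let $G$ be a $B_2$-EPG graph with a fixed $B_2$-EPG representation, let $a$ be a row and let $u,v$ be vertices whose index contains $a$. If the t-projections of $u$ and $v$ on $a$ intersect, then $uv$ is an edge of $G$. Moreover, if $a$ is the only row contained in the indices of both $u$ and $v$, then $uv$ is an edge of $G$ if and only if the t-projections of $u$ and $v$ on $a$ intersect.
   Context: An EPG representation of a graph $G$ assigns to every vertex $u$ a path $P_u$ in the rectangular grid, such that distinct $u,v$ are adjacent iff $P_u,P_v$ share a grid edge; a bend is a point where a path turns between horizontal and vertical; $G$ is $B_2$-EPG if some representation has every path with at most $2$ bends. Rows are horizontal grid lines, columns vertical ones; the point of row $a$ at column $\alpha$ is denoted $\alpha$. A vertex $u$ intersects a row if $P_u$ contains a grid edge of it; the index of $u$ is the set of rows it intersects. If $a$ is in the index of $u$, the extremities of $u$ on $a$ are the (exactly two) points of row $a$ at which $P_u$ stops or bends, and $P_u^a=[\alpha,\beta]$ is the segment of row $a$ between them. Types: $\emptyset$, $\downarrow$, $\uparrow$. A typed interval on row $a$ is $[x\alpha,y\beta]$ with $\alpha\le\beta$ points of row $a$ and $x,y$ types. For typed intervals $t=[x\alpha,y\beta]$, $t'=[x'\alpha',y'\beta']$ on row $a$ and an endpoint $z\gamma\in\{x'\alpha',y'\beta'\}$ of $t'$, $t$ is coherent with $z\gamma$ if (i) $\alpha<\gamma<\beta$, or (ii) $z=\emptyset$ and $[\alpha,\beta]$ contains the grid edge of $[\alpha',\beta']$ incident to $\gamma$, or (iii) $z\neq\emptyset$ and $z\gamma\in\{x\alpha,y\beta\}$.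 $t$ intersects $t'$ if $[\alpha,\beta]\cap[\alpha',\beta']$ contains a grid edge, or $t$ is coherent with an endpoint of $t'$, or $t'$ is coherent with an endpoint of $t$. The t-projection of $u$ on $a$ is $[x\alpha,y\beta]$ where $[\alpha,\beta]=P_u^a$ and the type of an extremity $\gamma$ is $\emptyset$ if $P_u$ stops at $\gamma$, $\downarrow$ if $P_u$ bends downwards at $\gamma$, $\uparrow$ if it bends upwards at $\gamma$. -}

module Defs where

open import Data.Nat using (ℕ; zero; suc)
import Data.Nat as ℕ
open import Data.Integer using (ℤ; _+_; _-_; _≤_; _<_; ∣_∣; 1ℤ)
import Data.Integer.Properties as ℤP
open import Data.Fin using (Fin)
import Data.Bool
open import Data.Bool using (Bool; true; false; _xor_; T)
open import Data.List using (List; []; _∷_; head; last)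
open import Data.List.Relation.Unary.Linked using (Linked)
open import Data.List.Relation.Unary.Unique.Propositional using (Unique)
open import Data.Maybe using (just)
open import Data.Product using (_×_; _,_; proj₁; proj₂; ∃; ∃-syntax)
open import Data.Sum using (_⊎_)
open import Relation.Nullary using (¬_)
open import Relation.Nullary.Decidable using (⌊_⌋)
open import Relation.Binary.PropositionalEquality using (_≡_; _≢_)
open import Function.Bundles using (_⇔_)

------------------------------------------------------------------------
-- The rectangular grid.  A grid point is (column , row) ∈ ℤ × ℤ.
-- Rows are horizontal lines (fixed second coordinate); "downwards"
-- means decreasing row coordinate.

Point : Set
Point = ℤ × ℤ

col : Point → ℤ
col = proj₁

row : Point → ℤ
row = proj₂

-- two grid points are adjacent (joined by a grid edge)
GridAdj : Point → Point → Set
GridAdj p q = ∣ col p - col q ∣ ℕ.+ ∣ row p - row q ∣ ≡ 1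

-- a path in the grid: a list of pairwise distinct points, consecutive
-- ones adjacent
IsGridPath : List Point → Set
IsGridPath P = Linked GridAdj P × Unique P

-- (p , q) are consecutive points of the path
data Consec : List Point → Point → Point → Set where
  here  : ∀ {p q xs} → Consec (p ∷ q ∷ xs) p q
  there : ∀ {x xs p q} → Consec xs p q → Consec (x ∷ xs) p q

-- (p , q , r) are consecutive points of the path
data Triple : List Point → Point → Point → Point → Set where
  here  : ∀ {p q r xs} → Triple (p ∷ q ∷ r ∷ xs) p q r
  there : ∀ {x xs p q r} → Triple xs p q r → Triple (x ∷ xs) p q r

-- the grid edge between adjacent points p q is horizontal
horizontal : Point → Point → Bool
horizontal p q = ⌊ row p ℤP.≟ row q ⌋

-- the path turns at q (between horizontal and vertical) when going p → q → r
isBend : Point → Point → Point → Bool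
isBend p q r = horizontal p q xor horizontal q r

-- number of bends of a path
bends : List Point → ℕ
bends (p ∷ rest@(q ∷ r ∷ xs)) = Data.Bool.if isBend p q r then suc (bends rest) else bends rest
bends _ = zero

-- the two paths share a grid edge
SharesEdge : List Point → List Point → Set
SharesEdge P Q = ∃[ p ] ∃[ q ] (Consec P p q × (Consec Q p q ⊎ Consec Q q p))

------------------------------------------------------------------------
-- Graphs and B₂-EPG representations

record Graph (n : ℕ) : Set₁ where
  field
    Adj    : Fin n → Fin n → Set
    sym    : ∀ {u v} → Adj u v → Adj v u
    irrefl : ∀ {u} → ¬ Adj u u

record B2Rep {n : ℕ} (G : Graph n) : Set₁ where
  field
    path    : Fin n → List Point
    isPath  : ∀ u → IsGridPath (path u)
    twoBend : ∀ u → bends (path u) ℕ.≤ 2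
    rep     : ∀ u v → u ≢ v → (Graph.Adj G u v ⇔ SharesEdge (path u) (path v))

------------------------------------------------------------------------
-- Rows, indices, extremities

-- the path intersects row a: it contains a grid edge of row a
InIndex : List Point → ℤ → Set
InIndex P a = ∃[ p ] ∃[ q ] (Consec P p q × row p ≡ a × row q ≡ a)

-- P stops at γ
StopsAt : List Point → Point → Set
StopsAt P γ = head P ≡ just γ ⊎ last P ≡ just γ

-- P bends at γ
BendsAt : List Point → Point → Set
BendsAt P γ = ∃[ p ] ∃[ r ] (Triple P p γ r × T (isBend p γ r))

-- γ is an extremity of P on row a: a point of row a where P stops or bends
Extremity : List Point → ℤ → Point → Set
Extremity P a γ = row γ ≡ a × (StopsAt P γ ⊎ BendsAt P γ)

-- types
data Ty : Set where
  ∅ ↓ ↑ : Ty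

-- the neighbour p of γ lies directly below / above γ
Below Above : Point → Point → Set
Below p γ = row p ≡ row γ - 1ℤ
Above p γ = row p ≡ row γ + 1ℤ

-- the type of the extremity γ of P
HasType : List Point → Point → Ty → Set
HasType P γ ∅ = StopsAt P γ
HasType P γ ↓ = ∃[ p ] ∃[ r ] (Triple P p γ r × T (isBend p γ r) × (Below p γ ⊎ Below r γ))
HasType P γ ↑ = ∃[ p ] ∃[ r ] (Triple P p γ r × T (isBend p γ r) × (Above p γ ⊎ Above r γ))

------------------------------------------------------------------------
-- Typed intervals on a row: [ x α , y β ]  (α ≤ β columns, x y types)

record TInterval : Set where
  constructor [_,_,_,_]
  field
    x : Ty
    α : ℤ
    y : Ty
    β : ℤ
open TInterval public

-- typed point zγ
TPoint : Set
TPoint = Ty × ℤ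

Endpoint : TInterval → TPoint → Set
Endpoint t zγ = zγ ≡ (x t , α t) ⊎ zγ ≡ (y t , β t)

-- [α , β] contains the grid edge between columns c and c+1
ContainsEdge : ℤ → ℤ → ℤ → Set
ContainsEdge α β c = α ≤ c × c + 1ℤ ≤ β

-- t is coherent with the endpoint zγ of t'
Coherent : TInterval → TInterval → TPoint → Set
Coherent t t' (z , γ) =
    (α t < γ × γ < β t)
  ⊎ (z ≡ ∅ × ∃[ c ] (ContainsEdge (α t') (β t') c × (γ ≡ c ⊎ γ ≡ c + 1ℤ)
                     × ContainsEdge (α t) (β t) c))
  ⊎ (z ≢ ∅ × Endpoint t (z , γ))

Intersect : TInterval → TInterval → Set
Intersect t t' =
    (∃[ c ] (ContainsEdge (α t) (β t) c × ContainsEdge (α t') (β t') c))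
  ⊎ (∃[ zγ ] (Endpoint t' zγ × Coherent t t' zγ))
  ⊎ (∃[ zγ ] (Endpoint t zγ × Coherent t' t zγ))

-- t is the t-projection of P on row a
TProj : List Point → ℤ → TInterval → Set
TProj P a [ x , α , y , β ] =
    α < β
  × Extremity P a (α , a) × Extremity P a (β , a)
  × (∀ γ → Extremity P a γ → γ ≡ (α , a) ⊎ γ ≡ (β , a))
  × HasType P (α , a) x × HasType P (β , a) y

-- the t-projections of P and Q on row a intersect
TProjIntersect : List Point → List Point → ℤ → Set
TProjIntersect P Q a = ∀ t t' → TProj P a t → TProj Q a t' → Intersect t t'

module Submission where

-- A path with at most two bends that uses an edge of row a meets row a in a single segment: walking
-- from that edge along the row in either direction, the path either stops or bends off the row, and
-- after a vertical step it has at most one bend left, so it can never come back to row a. Hence the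
-- edges of the path on row a are exactly the unit edges of its t-projection, and every vertical edge
-- of the path lies in the column of an extremity on row a, on the side given by the type of that
-- extremity. Intersecting t-projections therefore share an edge of row a, or an endpoint of the same
-- bend type together with the vertical edge leaving it. Conversely, if a is the only common row, a
-- common edge is either an edge of row a inside both t-projections or a vertical edge, which forces a
-- common endpoint of the same type.

open import Defs
open import Data.Fin using (Fin)
open import Data.Nat as ℕ using (ℕ; zero; suc)
import Data.Nat.Properties as ℕP
open import Data.Integer using (ℤ; _+_; _-_; _≤_; _<_; ∣_∣; 1ℤ; -1ℤ; +_; -[1+_]; -_; _◃_)
import Data.Integer.Properties as ℤP
open import Data.Integer.Tactic.RingSolver using (solve-∀)
import Data.Sign as Sign
open import Data.Sign using (Sign; opposite)
open import Data.Bool using (Bool; true; false; _xor_; T)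
open import Data.Bool.Properties using (xor-comm; T-≡)
open import Data.List using (List; []; _∷_; _++_; reverse; head; last; [_])
import Data.List.Properties as ListP
open import Data.List.Relation.Unary.All as All using (All; []; _∷_)
open import Data.List.Relation.Unary.AllPairs using ([]; _∷_)
open import Data.List.Relation.Unary.Linked using (Linked; _∷_)
open import Data.List.Relation.Unary.Unique.Propositional using (Unique)
open import Data.Maybe using (just)
open import Data.Product using (_×_; _,_; proj₁; proj₂; ∃; ∃-syntax)
open import Data.Sum using (_⊎_; inj₁; inj₂)
import Data.Sum
open import Data.Empty using (⊥; ⊥-elim)
open import Relation.Nullary using (¬_; yes; no)
open import Relation.Binary.PropositionalEquality hiding ([_])
open import Function using (_∘_; id)
open import Function.Bundles using (_⇔_; mk⇔; Equivalence)

-- Signed order on ℤ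

unit : Sign → ℤ
unit s = s ◃ 1

infix 4 _<[_]_ _≤[_]_

_<[_]_ : ℤ → Sign → ℤ → Set
i <[ Sign.+ ] j = i < j
i <[ Sign.- ] j = j < i

_≤[_]_ : ℤ → Sign → ℤ → Set
i ≤[ Sign.+ ] j = i ≤ j
i ≤[ Sign.- ] j = j ≤ i

<⇒+1≤ : ∀ {i j} → i < j → i + 1ℤ ≤ j
<⇒+1≤ {i} {j} p = subst (_≤ j) (ℤP.+-comm 1ℤ i) (ℤP.i<j⇒suc[i]≤j p)

+1≤⇒< : ∀ {i j} → i + 1ℤ ≤ j → i < j
+1≤⇒< {i} {j} p = ℤP.suc[i]≤j⇒i<j (subst (_≤ j) (ℤP.+-comm i 1ℤ) p)

<+1⇒≤ : ∀ {i j} → i < j + 1ℤ → i ≤ j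
<+1⇒≤ p = ℤP.≮⇒≥ λ j<i → ℤP.<⇒≱ p (<⇒+1≤ j<i)

i-1+1≡i : ∀ i → i + -1ℤ + 1ℤ ≡ i
i-1+1≡i = solve-∀

<⇒≤-1 : ∀ {i j} → i < j → i ≤ j + -1ℤ
<⇒≤-1 {i} {j} i<j = <+1⇒≤ (subst (i <_) (sym (i-1+1≡i j)) i<j)

i+unit-opposite : ∀ s i → i + unit s + unit (opposite s) ≡ i
i+unit-opposite Sign.+ = solve-∀
i+unit-opposite Sign.- = solve-∀

i<[s]i+unit : ∀ s i → i <[ s ] i + unit s
i<[s]i+unit Sign.+ i = +1≤⇒< ℤP.≤-refl
i<[s]i+unit Sign.- i = +1≤⇒< (ℤP.≤-reflexive (i-1+1≡i i))

i≢i+unit : ∀ s i → i ≢ i + unit s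
i≢i+unit Sign.+ i e = ℤP.<-irrefl e (i<[s]i+unit Sign.+ i)
i≢i+unit Sign.- i e = ℤP.<-irrefl (sym e) (i<[s]i+unit Sign.- i)

stepBack : ∀ {s i j} → j ≡ i + unit s → i ≡ j + unit (opposite s)
stepBack {s} {i} refl = sym (i+unit-opposite s i)

<[]-irrefl : ∀ s {i} → ¬ i <[ s ] i
<[]-irrefl Sign.+ = ℤP.<-irrefl refl
<[]-irrefl Sign.- = ℤP.<-irrefl refl

<[]⇒≤[] : ∀ s {i j} → i <[ s ] j → i ≤[ s ] j
<[]⇒≤[] Sign.+ = ℤP.<⇒≤
<[]⇒≤[] Sign.- = ℤP.<⇒≤

≤[]-refl : ∀ s {i} → i ≤[ s ] i
≤[]-refl Sign.+ = ℤP.≤-refl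
≤[]-refl Sign.- = ℤP.≤-refl

≤[]-trans : ∀ s {i j k} → i ≤[ s ] j → j ≤[ s ] k → i ≤[ s ] k
≤[]-trans Sign.+ p q = ℤP.≤-trans p q
≤[]-trans Sign.- p q = ℤP.≤-trans q p

<[]-trans : ∀ s {i j k} → i <[ s ] j → j <[ s ] k → i <[ s ] k
<[]-trans Sign.+ p q = ℤP.<-trans p q
<[]-trans Sign.- p q = ℤP.<-trans q p

≤[]-<[]-trans : ∀ s {i j k} → i ≤[ s ] j → j <[ s ] k → i <[ s ] k
≤[]-<[]-trans Sign.+ p q = ℤP.≤-<-trans p q
≤[]-<[]-trans Sign.- p q = ℤP.<-≤-trans q p

≤[]⇒<[]+unit : ∀ s {i j} → i ≤[ s ] j → i <[ s ] j + unit s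
≤[]⇒<[]+unit s p = ≤[]-<[]-trans s p (i<[s]i+unit s _)

+unit≤[]⇒≤[] : ∀ s {i j} → i + unit s ≤[ s ] j → i ≤[ s ] j
+unit≤[]⇒≤[] s p = ≤[]-trans s (<[]⇒≤[] s (i<[s]i+unit s _)) p

≤[]∧<[]+unit⇒≡ : ∀ s {i j} → i ≤[ s ] j → j <[ s ] i + unit s → j ≡ i
≤[]∧<[]+unit⇒≡ Sign.+ p q = ℤP.≤-antisym (<+1⇒≤ q) p
≤[]∧<[]+unit⇒≡ Sign.- {i} {j} p q =
  ℤP.≤-antisym p (subst (_≤ j) (i-1+1≡i i) (<⇒+1≤ q))

≤[]⇒≡⊎+unit≤[] : ∀ s {i j} → i ≤[ s ] j → j ≡ i ⊎ i + unit s ≤[ s ] j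
≤[]⇒≡⊎+unit≤[] s {i} {j} p with j ℤP.≟ i
... | yes j≡i = inj₁ j≡i
... | no j≢i = inj₂ (step s p j≢i)
  where
  step : ∀ s → i ≤[ s ] j → j ≢ i → i + unit s ≤[ s ] j
  step Sign.+ p j≢i = <⇒+1≤ (ℤP.≤∧≢⇒< p (j≢i ∘ sym))
  step Sign.- p j≢i = <+1⇒≤ (subst (j <_) (sym (i-1+1≡i i)) (ℤP.≤∧≢⇒< p j≢i))

≤[]∧≤[]⇒≡ : ∀ {s t i j} → t ≢ s → i ≤[ s ] j → i ≤[ t ] j → j ≡ i
≤[]∧≤[]⇒≡ {Sign.+} {Sign.-} _ p q = ℤP.≤-antisym q p
≤[]∧≤[]⇒≡ {Sign.-} {Sign.+} _ p q = ℤP.≤-antisym p q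
≤[]∧≤[]⇒≡ {Sign.+} {Sign.+} t≢s _ _ = ⊥-elim (t≢s refl)
≤[]∧≤[]⇒≡ {Sign.-} {Sign.-} t≢s _ _ = ⊥-elim (t≢s refl)

≢⇒≡opposite : ∀ {s t} → t ≢ s → t ≡ opposite s
≢⇒≡opposite {Sign.+} {Sign.+} t≢s = ⊥-elim (t≢s refl)
≢⇒≡opposite {Sign.+} {Sign.-} _ = refl
≢⇒≡opposite {Sign.-} {Sign.+} _ = refl
≢⇒≡opposite {Sign.-} {Sign.-} t≢s = ⊥-elim (t≢s refl)

-- Grid geometry

j≡i+-[i-j] : ∀ i j → j ≡ i + - (i - j)
j≡i+-[i-j] = solve-∀

∣i-j∣≡1⇒step : ∀ i j → ∣ i - j ∣ ≡ 1 → ∃[ s ] j ≡ i + unit s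
∣i-j∣≡1⇒step i j ∣i-j∣≡1 with i - j | j≡i+-[i-j] i j | ∣i-j∣≡1
... | + 1          | eq | _ = Sign.- , eq
... | -[1+ 0 ]     | eq | _ = Sign.+ , eq
... | + 0          | _ | ()
... | + suc (suc _) | _ | ()
... | -[1+ suc _ ] | _ | ()

∣i-i∣≡0 : ∀ i → ∣ i - i ∣ ≡ 0
∣i-i∣≡0 i = cong ∣_∣ (ℤP.i≡j⇒i-j≡0 {i} refl)

∣i-j∣≡0⇒i≡j : ∀ {i j} → ∣ i - j ∣ ≡ 0 → i ≡ j
∣i-j∣≡0⇒i≡j {i} {j} e = ℤP.i-j≡0⇒i≡j i j (ℤP.∣i∣≡0⇒i≡0 e)

m+n≡1∧n≢0⇒ : ∀ m n → m ℕ.+ n ≡ 1 → n ≢ 0 → m ≡ 0 × n ≡ 1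
m+n≡1∧n≢0⇒ zero n e _ = refl , e
m+n≡1∧n≢0⇒ (suc m) n e n≢0 = ⊥-elim (n≢0 (ℕP.m+n≡0⇒n≡0 m (ℕP.suc-injective e)))

GridAdj-sym : ∀ {p q} → GridAdj p q → GridAdj q p
GridAdj-sym {p} {q} =
  subst (_≡ 1) (cong₂ ℕ._+_ (ℤP.∣i-j∣≡∣j-i∣ (col p) (col q)) (ℤP.∣i-j∣≡∣j-i∣ (row p) (row q)))

horizontalStep : ∀ {p q} → GridAdj p q → row p ≡ row q → ∃[ s ] col q ≡ col p + unit s
horizontalStep {p} {q} adj refl = ∣i-j∣≡1⇒step (col p) (col q) ∣Δcol∣≡1
  where
  ∣Δcol∣≡1 : ∣ col p - col q ∣ ≡ 1
  ∣Δcol∣≡1 = trans (sym (ℕP.+-identityʳ _)) (subst (λ k → ∣ col p - col q ∣ ℕ.+ k ≡ 1) (∣i-i∣≡0 (row p)) adj)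

verticalStep : ∀ {p q} → GridAdj p q → row p ≢ row q → col q ≡ col p × ∃[ s ] row q ≡ row p + unit s
verticalStep {p} {q} adj rp≢rq with m+n≡1∧n≢0⇒ _ _ adj (rp≢rq ∘ ∣i-j∣≡0⇒i≡j)
... | ∣Δcol∣≡0 , ∣Δrow∣≡1 = sym (∣i-j∣≡0⇒i≡j ∣Δcol∣≡0) , ∣i-j∣≡1⇒step (row p) (row q) ∣Δrow∣≡1

rowStep : ∀ {c a z} → GridAdj (c , a) z → a ≡ row z → ∃[ s ] z ≡ (c + unit s , a)
rowStep {c} {a} {z} adj a≡ with horizontalStep {c , a} {z} adj a≡
... | s , cz = s , cong₂ _,_ cz (sym a≡)

columnStep : ∀ {c b z} → GridAdj (c , b) z → b ≢ row z → ∃[ d ] z ≡ (c , b + unit d)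
columnStep {c} {b} {z} adj b≢ with verticalStep {c , b} {z} adj b≢
... | cz , d , rz = d , cong₂ _,_ cz rz

GridAdj⇒≢ : ∀ {p q} → GridAdj p q → p ≢ q
GridAdj⇒≢ {p} adj refl = ℕP.0≢1+n (trans (sym (cong₂ ℕ._+_ (∣i-i∣≡0 (col p)) (∣i-i∣≡0 (row p)))) adj)

horizontal-true : ∀ {p q} → horizontal p q ≡ true → row p ≡ row q
horizontal-true {p} {q} h with row p ℤP.≟ row q
... | yes e = e

horizontal-false : ∀ {p q} → horizontal p q ≡ false → row p ≢ row q
horizontal-false {p} {q} h with row p ℤP.≟ row q
... | no ne = ne

horizontal-yes : ∀ {p q} → row p ≡ row q → horizontal p q ≡ true
horizontal-yes {p} {q} e with row p ℤP.≟ row q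
... | yes _ = refl
... | no ne = ⊥-elim (ne e)

horizontal-no : ∀ {p q} → row p ≢ row q → horizontal p q ≡ false
horizontal-no {p} {q} ne with row p ℤP.≟ row q
... | yes e = ⊥-elim (ne e)
... | no _ = refl

horizontal-sym : ∀ p q → horizontal p q ≡ horizontal q p
horizontal-sym p q with row p ℤP.≟ row q | row q ℤP.≟ row p
... | yes _  | yes _  = refl
... | no _   | no _   = refl
... | yes e  | no ne  = ⊥-elim (ne (sym e))
... | no ne  | yes e  = ⊥-elim (ne (sym e))

isBend-sym : ∀ p q r → isBend p q r ≡ isBend r q p
isBend-sym p q r = trans (cong₂ _xor_ (horizontal-sym p q) (horizontal-sym q r))
                         (xor-comm (horizontal q p) (horizontal r q))

horizontal-next : ∀ p q r {b h} → isBend p q r ≡ b → horizontal p q ≡ h → horizontal q r ≡ b xor h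
horizontal-next p q r refl refl with horizontal p q | horizontal q r
... | true  | true  = refl
... | true  | false = refl
... | false | true  = refl
... | false | false = refl

horizontal-rowStep : ∀ s c a → horizontal (c , a) (c + unit s , a) ≡ true
horizontal-rowStep s c a = horizontal-yes {c , a} {c + unit s , a} refl

horizontal-columnStep : ∀ s c b → horizontal (c , b) (c , b + unit s) ≡ false
horizontal-columnStep s c b = horizontal-no {c , b} {c , b + unit s} (i≢i+unit s b)

-- Paths as lists of points

Consec-++ʳ : ∀ pre {L p q} → Consec L p q → Consec (pre ++ L) p q
Consec-++ʳ [] c = c
Consec-++ʳ (_ ∷ pre) c = there (Consec-++ʳ pre c)

Triple-++ʳ : ∀ pre {L p q r} → Triple L p q r → Triple (pre ++ L) p q r
Triple-++ʳ [] t = t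
Triple-++ʳ (_ ∷ pre) t = there (Triple-++ʳ pre t)

Consec-split : ∀ {P p q} → Consec P p q → ∃[ pre ] ∃[ post ] P ≡ pre ++ p ∷ q ∷ post
Consec-split (here {xs = post}) = [] , post , refl
Consec-split (there {x = x} c) with Consec-split c
... | pre , post , refl = x ∷ pre , post , refl

Triple-split : ∀ {P p q r} → Triple P p q r → ∃[ pre ] ∃[ post ] P ≡ pre ++ p ∷ q ∷ r ∷ post
Triple-split (here {xs = post}) = [] , post , refl
Triple-split (there {x = x} t) with Triple-split t
... | pre , post , refl = x ∷ pre , post , refl

Triple⇒Consec₁ : ∀ {L p q r} → Triple L p q r → Consec L p q
Triple⇒Consec₁ here = here
Triple⇒Consec₁ (there t) = there (Triple⇒Consec₁ t)

Triple⇒Consec₂ : ∀ {L p q r} → Triple L p q r → Consec L q r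
Triple⇒Consec₂ here = there here
Triple⇒Consec₂ (there t) = there (Triple⇒Consec₂ t)

reverse-++-++ : ∀ (pre mid post : List Point) → reverse (pre ++ mid ++ post) ≡ reverse post ++ reverse mid ++ reverse pre
reverse-++-++ pre mid post = begin
  reverse (pre ++ mid ++ post)                  ≡⟨ ListP.reverse-++ pre (mid ++ post) ⟩
  reverse (mid ++ post) ++ reverse pre          ≡⟨ cong (_++ reverse pre) (ListP.reverse-++ mid post) ⟩
  (reverse post ++ reverse mid) ++ reverse pre  ≡⟨ ListP.++-assoc (reverse post) (reverse mid) (reverse pre) ⟩
  reverse post ++ reverse mid ++ reverse pre    ∎
  where open ≡-Reasoning

Consec-reverse : ∀ {P p q} → Consec P p q → Consec (reverse P) q p
Consec-reverse {p = p} {q} c with Consec-split c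
... | pre , post , refl =
  subst (λ X → Consec X q p) (sym (reverse-++-++ pre (p ∷ q ∷ []) post)) (Consec-++ʳ (reverse post) here)

Triple-reverse : ∀ {P p q r} → Triple P p q r → Triple (reverse P) r q p
Triple-reverse {p = p} {q} {r} t with Triple-split t
... | pre , post , refl =
  subst (λ X → Triple X r q p) (sym (reverse-++-++ pre (p ∷ q ∷ r ∷ []) post)) (Triple-++ʳ (reverse post) here)

Consec-reverse⁻ : ∀ {P p q} → Consec (reverse P) p q → Consec P q p
Consec-reverse⁻ {P} c = subst (λ X → Consec X _ _) (ListP.reverse-involutive P) (Consec-reverse c)

Triple-reverse⁻ : ∀ {P p q r} → Triple (reverse P) p q r → Triple P r q p
Triple-reverse⁻ {P} t = subst (λ X → Triple X _ _ _) (ListP.reverse-involutive P) (Triple-reverse t)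

last-++ : ∀ (pre : List Point) {y ys} → last (pre ++ y ∷ ys) ≡ last (y ∷ ys)
last-++ [] = refl
last-++ (_ ∷ []) = refl
last-++ (_ ∷ x ∷ pre) = last-++ (x ∷ pre)

last-reverse : ∀ (P : List Point) → last (reverse P) ≡ head P
last-reverse [] = refl
last-reverse (x ∷ P) = trans (cong last (ListP.unfold-reverse x P)) (last-∷ʳ (reverse P))
  where
  last-∷ʳ : ∀ ys → last (ys ++ [ x ]) ≡ just x
  last-∷ʳ [] = refl
  last-∷ʳ (_ ∷ []) = refl
  last-∷ʳ (_ ∷ y ∷ ys) = last-∷ʳ (y ∷ ys)

head-reverse : ∀ (P : List Point) → head (reverse P) ≡ last P
head-reverse P = trans (sym (last-reverse (reverse P))) (cong last (ListP.reverse-involutive P))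

head-++ : ∀ (pre : List Point) {y ys zs} → head (pre ++ y ∷ ys) ≡ head (pre ++ y ∷ zs)
head-++ [] = refl
head-++ (_ ∷ _) = refl

Consec-++⁻ : ∀ xs {y ys p q} → Consec (xs ++ y ∷ ys) p q → Consec (y ∷ ys) p q ⊎ Consec (xs ++ [ y ]) p q
Consec-++⁻ [] c = inj₁ c
Consec-++⁻ (_ ∷ []) here = inj₂ here
Consec-++⁻ (_ ∷ _ ∷ _) here = inj₂ here
Consec-++⁻ (_ ∷ xs) (there c) = Data.Sum.map₂ there (Consec-++⁻ xs c)

Triple-++⁻ : ∀ xs {y z ys p q r} → Triple (xs ++ y ∷ z ∷ ys) p q r
           → Triple (y ∷ z ∷ ys) p q r ⊎ Triple (xs ++ y ∷ z ∷ []) p q r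
Triple-++⁻ [] t = inj₁ t
Triple-++⁻ (_ ∷ []) here = inj₂ here
Triple-++⁻ (_ ∷ _ ∷ []) here = inj₂ here
Triple-++⁻ (_ ∷ _ ∷ _ ∷ _) here = inj₂ here
Triple-++⁻ (_ ∷ xs) (there t) = Data.Sum.map₂ there (Triple-++⁻ xs t)

indicator : Bool → ℕ
indicator true = 1
indicator false = 0

firstBend : Point → List Point → ℕ
firstBend x (y ∷ z ∷ _) = indicator (isBend x y z)
firstBend _ _ = 0

bends-∷ : ∀ x L → bends (x ∷ L) ≡ firstBend x L ℕ.+ bends L
bends-∷ x [] = refl
bends-∷ x (y ∷ []) = refl
bends-∷ x (y ∷ z ∷ zs) with isBend x y z
... | true = refl
... | false = refl

firstBend-++ : ∀ w (ws : List Point) y z x → firstBend w (ws ++ y ∷ z ∷ x ∷ []) ≡ firstBend w (ws ++ y ∷ z ∷ [])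
firstBend-++ w [] y z x = refl
firstBend-++ w (_ ∷ []) y z x = refl
firstBend-++ w (_ ∷ _ ∷ _) y z x = refl

bends-∷ʳ : ∀ ws y z x → bends (ws ++ y ∷ z ∷ x ∷ []) ≡ bends (ws ++ y ∷ z ∷ []) ℕ.+ indicator (isBend y z x)
bends-∷ʳ [] y z x = trans (bends-∷ y (z ∷ x ∷ [])) (ℕP.+-identityʳ _)
bends-∷ʳ (w ∷ ws) y z x = begin
  bends (w ∷ ws ++ y ∷ z ∷ x ∷ [])
    ≡⟨ bends-∷ w (ws ++ y ∷ z ∷ x ∷ []) ⟩
  firstBend w (ws ++ y ∷ z ∷ x ∷ []) ℕ.+ bends (ws ++ y ∷ z ∷ x ∷ [])
    ≡⟨ cong₂ ℕ._+_ (firstBend-++ w ws y z x) (bends-∷ʳ ws y z x) ⟩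
  firstBend w (ws ++ y ∷ z ∷ []) ℕ.+ (bends (ws ++ y ∷ z ∷ []) ℕ.+ b)
    ≡⟨ sym (ℕP.+-assoc (firstBend w (ws ++ y ∷ z ∷ [])) _ b) ⟩
  (firstBend w (ws ++ y ∷ z ∷ []) ℕ.+ bends (ws ++ y ∷ z ∷ [])) ℕ.+ b
    ≡⟨ cong (ℕ._+ b) (sym (bends-∷ w (ws ++ y ∷ z ∷ []))) ⟩
  bends (w ∷ ws ++ y ∷ z ∷ []) ℕ.+ b
    ∎
  where
  open ≡-Reasoning
  b : ℕ
  b = indicator (isBend y z x)

bends-reverse : ∀ P → bends (reverse P) ≡ bends P
bends-reverse [] = refl
bends-reverse (_ ∷ []) = refl
bends-reverse (_ ∷ _ ∷ []) = refl
bends-reverse (x ∷ y ∷ z ∷ zs) = begin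
  bends (reverse (x ∷ y ∷ z ∷ zs))
    ≡⟨ cong bends (ListP.reverse-++ (x ∷ y ∷ z ∷ []) zs) ⟩
  bends (reverse zs ++ z ∷ y ∷ x ∷ [])
    ≡⟨ bends-∷ʳ (reverse zs) z y x ⟩
  bends (reverse zs ++ z ∷ y ∷ []) ℕ.+ indicator (isBend z y x)
    ≡⟨ cong (ℕ._+ _) (sym (cong bends (ListP.reverse-++ (y ∷ z ∷ []) zs))) ⟩
  bends (reverse (y ∷ z ∷ zs)) ℕ.+ indicator (isBend z y x)
    ≡⟨ cong₂ ℕ._+_ (bends-reverse (y ∷ z ∷ zs)) (cong indicator (isBend-sym z y x)) ⟩
  bends (y ∷ z ∷ zs) ℕ.+ indicator (isBend x y z)
    ≡⟨ ℕP.+-comm (bends (y ∷ z ∷ zs)) _ ⟩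
  indicator (isBend x y z) ℕ.+ bends (y ∷ z ∷ zs)
    ≡⟨ sym (bends-∷ x (y ∷ z ∷ zs)) ⟩
  bends (x ∷ y ∷ z ∷ zs)
    ∎
  where open ≡-Reasoning

bends-++ʳ : ∀ pre L → bends L ℕ.≤ bends (pre ++ L)
bends-++ʳ [] L = ℕP.≤-refl
bends-++ʳ (x ∷ pre) L =
  ℕP.≤-trans (bends-++ʳ pre L) (subst (bends (pre ++ L) ℕ.≤_) (sym (bends-∷ x (pre ++ L))) (ℕP.m≤n+m _ _))

module _ {Q : Point → Set} where

  All-Consec : ∀ {L p q} → All Q L → Consec L p q → Q p × Q q
  All-Consec (Qp ∷ Qq ∷ _) here = Qp , Qq
  All-Consec (_ ∷ all) (there c) = All-Consec all c

  All-Triple : ∀ {L p q r} → All Q L → Triple L p q r → Q q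
  All-Triple (_ ∷ Qq ∷ _) here = Qq
  All-Triple (_ ∷ all) (there t) = All-Triple all t

  All-last : ∀ {L γ} → All Q L → last L ≡ just γ → Q γ
  All-last (Qγ ∷ []) refl = Qγ
  All-last (_ ∷ all@(_ ∷ _)) e = All-last all e

Unique⇒noBacktrack : ∀ {P p q r} → Unique P → Triple P p q r → p ≢ r
Unique⇒noBacktrack ((_ ∷ p≢r ∷ _) ∷ _) here = p≢r
Unique⇒noBacktrack (_ ∷ u) (there t) = Unique⇒noBacktrack u t

StopsAt⇒¬Triple : ∀ {P p γ r} → Unique P → StopsAt P γ → ¬ Triple P p γ r
StopsAt⇒¬Triple ((x≢γ ∷ _) ∷ _) (inj₁ refl) here = x≢γ refl
StopsAt⇒¬Triple (x≢ ∷ _) (inj₁ refl) (there t) = All-Triple x≢ t refl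
StopsAt⇒¬Triple (_ ∷ (γ≢ ∷ _)) (inj₂ l) here = All-last γ≢ l refl
StopsAt⇒¬Triple {_ ∷ _ ∷ _} (_ ∷ u) (inj₂ l) (there t) = StopsAt⇒¬Triple u (inj₂ l) t

Triple-unique : ∀ {P p γ r p' r'} → Unique P → Triple P p γ r → Triple P p' γ r' → p ≡ p' × r ≡ r'
Triple-unique _ here here = refl , refl
Triple-unique (_ ∷ ((γ≢γ ∷ _) ∷ _)) here (there here) = ⊥-elim (γ≢γ refl)
Triple-unique (_ ∷ (γ≢ ∷ _)) here (there (there t)) = ⊥-elim (All-Triple γ≢ t refl)
Triple-unique (_ ∷ ((γ≢γ ∷ _) ∷ _)) (there here) here = ⊥-elim (γ≢γ refl)
Triple-unique (_ ∷ (γ≢ ∷ _)) (there (there t)) here = ⊥-elim (All-Triple γ≢ t refl)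
Triple-unique (_ ∷ u) (there t) (there t') = Triple-unique u t t'

-- Walks and their bends

Steps : List Point → Set
Steps L = ∀ {p q} → Consec L p q → GridAdj p q

NoBacktrack : List Point → Set
NoBacktrack L = ∀ {p q r} → Triple L p q r → p ≢ r

Linked⇒Steps : ∀ {P} → Linked GridAdj P → Steps P
Linked⇒Steps (adj ∷ _) here = adj
Linked⇒Steps (_ ∷ linked) (there e) = Linked⇒Steps linked e

Edge : List Point → Point → Point → Set
Edge L p q = Consec L p q ⊎ Consec L q p

HasRowEdge : List Point → ℤ → ℤ → Set
HasRowEdge L a c = Edge L (c , a) (c + 1ℤ , a)

Edge⇒SharesEdge : ∀ {P Q p q} → Edge P p q → Edge Q p q → SharesEdge P Q
Edge⇒SharesEdge (inj₁ cP) eQ = _ , _ , cP , eQ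
Edge⇒SharesEdge (inj₂ cP) eQ = _ , _ , cP , Data.Sum.swap eQ

SharesEdge-sym : ∀ {P Q} → SharesEdge P Q → SharesEdge Q P
SharesEdge-sym (_ , _ , cP , eQ) = Edge⇒SharesEdge eQ (inj₁ cP)

EndOrBend : List Point → Point → Set
EndOrBend L γ = last L ≡ just γ ⊎ BendsAt L γ

bendTy : Sign → Ty
bendTy Sign.+ = ↑
bendTy Sign.- = ↓

bendTy≢∅ : ∀ d → bendTy d ≢ ∅
bendTy≢∅ Sign.+ ()
bendTy≢∅ Sign.- ()

BendType : List Point → Point → Sign → Set
BendType L γ d = ∃[ p ] ∃[ r ] (Triple L p γ r × T (isBend p γ r) × (row p ≡ row γ + unit d ⊎ row r ≡ row γ + unit d))

BendType⇔HasType : ∀ {L γ} d → BendType L γ d ⇔ HasType L γ (bendTy d)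
BendType⇔HasType Sign.+ = mk⇔ id id
BendType⇔HasType Sign.- = mk⇔ id id

BendType⇒BendsAt : ∀ {L γ d} → BendType L γ d → BendsAt L γ
BendType⇒BendsAt (p , r , t , b , _) = p , r , t , b

-- each vertical edge lies weakly on one side d of row a, in the column of a bend of type d on row a
VerticalEdgesBend : List Point → ℤ → Set
VerticalEdgesBend L a = ∀ {p q} → Consec L p q → col p ≡ col q
                      → ∃[ d ] (a ≤[ d ] row p × a ≤[ d ] row q × BendType L (col p , a) d)

VerticalEdgesBend-Edge : ∀ {L a p q} → VerticalEdgesBend L a → Edge L p q → col p ≡ col q
                       → ∃[ d ] (a ≤[ d ] row p × a ≤[ d ] row q × BendType L (col p , a) d)
VerticalEdgesBend-Edge vertical (inj₁ e) cp≡cq = vertical e cp≡cq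
VerticalEdgesBend-Edge {L} {a} vertical (inj₂ e) cp≡cq with vertical e (sym cp≡cq)
... | d , aq , ap , bend = d , ap , aq , subst (λ k → BendType L (k , a) d) (sym cp≡cq) bend

record SubWalk (L P : List Point) : Set where
  field
    consec : ∀ {p q} → Consec L p q → Edge P p q
    triple : ∀ {p q r} → Triple L p q r → Triple P p q r ⊎ Triple P r q p
    last⇒stops : ∀ {γ} → last L ≡ just γ → StopsAt P γ

  steps : Steps P → Steps L
  steps stP {p} {q} c with consec c
  ... | inj₁ c' = stP c'
  ... | inj₂ c' = GridAdj-sym {q} {p} (stP c')

  noBacktrack : NoBacktrack P → NoBacktrack L
  noBacktrack nbP t with triple t
  ... | inj₁ t' = nbP t'
  ... | inj₂ t' = nbP t' ∘ sym

  bendType : ∀ {γ d} → BendType L γ d → BendType P γ d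
  bendType {γ} (p , r , t , b , v) with triple t
  ... | inj₁ t' = p , r , t' , b , v
  ... | inj₂ t' = r , p , t' , subst T (isBend-sym p γ r) b , Data.Sum.swap v

  bendsAt : ∀ {γ} → BendsAt L γ → BendsAt P γ
  bendsAt {γ} (p , r , t , b) with triple t
  ... | inj₁ t' = p , r , t' , b
  ... | inj₂ t' = r , p , t' , subst T (isBend-sym p γ r) b

  endOrBend : ∀ {γ} → EndOrBend L γ → StopsAt P γ ⊎ BendsAt P γ
  endOrBend = Data.Sum.map last⇒stops bendsAt

SubWalk-++ʳ : ∀ pre {y ys} → SubWalk (y ∷ ys) (pre ++ y ∷ ys)
SubWalk-++ʳ pre = record
  { consec = inj₁ ∘ Consec-++ʳ pre
  ; triple = inj₁ ∘ Triple-++ʳ pre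
  ; last⇒stops = λ l → inj₂ (trans (last-++ pre) l)
  }

SubWalk-reverse : ∀ {L P} → SubWalk L (reverse P) → SubWalk L P
SubWalk-reverse {L} {P} S = record
  { consec = Data.Sum.map Consec-reverse⁻ Consec-reverse⁻ ∘ Data.Sum.swap ∘ consec
  ; triple = Data.Sum.map Triple-reverse⁻ Triple-reverse⁻ ∘ Data.Sum.swap ∘ triple
  ; last⇒stops = stops ∘ last⇒stops
  }
  where
  open SubWalk S
  stops : ∀ {γ} → StopsAt (reverse P) γ → StopsAt P γ
  stops (inj₁ h) = inj₂ (trans (sym (head-reverse P)) h)
  stops (inj₂ l) = inj₁ (trans (sym (last-reverse P)) l)

-- The segment of a walk on a row

sameDirection : ∀ {s t i} → i + unit s + unit t ≢ i → t ≡ s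
sameDirection {s} {t} {i} ne with t Sign.≟ s
... | yes t≡s = t≡s
... | no t≢s = ⊥-elim (ne (subst (λ t → i + unit s + unit t ≡ i) (sym (≢⇒≡opposite t≢s)) (i+unit-opposite s i)))

straightOnRow : ∀ s {c a r} → GridAdj (c + unit s , a) r → horizontal (c + unit s , a) r ≡ true
              → r ≢ (c , a) → r ≡ (c + unit s + unit s , a)
straightOnRow s {c} {a} {r} adj hor r≢ with rowStep {c + unit s} {a} {r} adj (horizontal-true {c + unit s , a} {r} hor)
... | t , refl with sameDirection {s} {t} {c} (λ e → r≢ (cong (_, a) e))
... | refl = refl

straightOnColumn : ∀ d {c b r} → GridAdj (c , b + unit d) r → horizontal (c , b + unit d) r ≡ false
                 → r ≢ (c , b) → r ≡ (c , b + unit d + unit d)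
straightOnColumn d {c} {b} {r} adj hor r≢ with columnStep {c} {b + unit d} {r} adj (horizontal-false {c , b + unit d} {r} hor)
... | t , refl with sameDirection {d} {t} {b} (λ e → r≢ (cong (c ,_) e))
... | refl = refl

straightRow : ∀ {z z' rest} → horizontal z z' ≡ true → bends (z ∷ z' ∷ rest) ≡ 0
            → All (λ p → row p ≡ row z) (z ∷ z' ∷ rest)
straightRow {z} {z'} {[]} hor _ = refl ∷ sym (horizontal-true {z} {z'} hor) ∷ []
straightRow {z} {z'} {z'' ∷ rest} hor b with isBend z z' z'' in eb
... | false = refl ∷ All.map (λ e → trans e (sym (horizontal-true {z} {z'} hor)))
                             (straightRow (horizontal-next z z' z'' eb hor) b)

leaveRow : ∀ d {a} c b {rest} → Steps ((c , b) ∷ (c , b + unit d) ∷ rest) → NoBacktrack ((c , b) ∷ (c , b + unit d) ∷ rest)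
         → a ≤[ d ] b → bends ((c , b) ∷ (c , b + unit d) ∷ rest) ℕ.≤ 1
         → All (λ p → a <[ d ] row p) ((c , b + unit d) ∷ rest)
           × (∀ {p q} → Consec ((c , b) ∷ (c , b + unit d) ∷ rest) p q → col p ≡ col q → col p ≡ c)
leaveRow d c b {[]} _ _ a≤b _ = ≤[]⇒<[]+unit d a≤b ∷ [] , λ { here _ → refl ; (there (there ())) }
leaveRow d c b {z ∷ rest} st nb a≤b bnd with isBend (c , b) (c , b + unit d) z in eb
... | false
  with straightOnColumn d (st (there here)) (horizontal-next (c , b) (c , b + unit d) z eb (horizontal-columnStep d c b))
                        (nb here ∘ sym)
...   | refl with leaveRow d c (b + unit d) (st ∘ there) (nb ∘ there) (<[]⇒≤[] d (≤[]⇒<[]+unit d a≤b)) bnd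
...     | beyond , column = ≤[]⇒<[]+unit d a≤b ∷ beyond , λ { here _ → refl ; (there e) → column e }
leaveRow d {a} c b {z ∷ rest} st nb a≤b bnd | true =
  All.map (λ e → subst (_ <[ d ]_) (sym e) a<b+d) onRow , column
  where
  a<b+d : a <[ d ] b + unit d
  a<b+d = ≤[]⇒<[]+unit d a≤b
  onRow : All (λ p → row p ≡ b + unit d) ((c , b + unit d) ∷ z ∷ rest)
  onRow = straightRow (horizontal-next (c , b) (c , b + unit d) z eb (horizontal-columnStep d c b))
                      (ℕP.n≤0⇒n≡0 (ℕ.s≤s⁻¹ bnd))
  column : ∀ {p q} → Consec ((c , b) ∷ (c , b + unit d) ∷ z ∷ rest) p q → col p ≡ col q → col p ≡ c
  column here _ = refl
  column {p} {q} (there e) cp≡cq with All-Consec onRow e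
  ... | rp , rq = ⊥-elim (GridAdj⇒≢ {p} {q} (st (there e)) (cong₂ _,_ cp≡cq (trans rp (sym rq))))

record RowRun (L : List Point) (a : ℤ) (h : Sign) (start : ℤ) : Set where
  field
    end : ℤ
    start<end : start <[ h ] end
    endOrBend-end : EndOrBend L (end , a)
    endOrBend-unique : ∀ γ → row γ ≡ a → EndOrBend L γ → γ ≡ (end , a)
    covers : ∀ c → start ≤[ h ] c → c <[ h ] end → Consec L (c , a) (c + unit h , a)
    rowEdge : ∀ {p q} → Consec L p q → row p ≡ a → row q ≡ a
            → start ≤[ h ] col p × col p <[ h ] end × col q ≡ col p + unit h
    verticalEdge : VerticalEdgesBend L a

module _ {a : ℤ} (h : Sign) (c : ℤ) where

  private
    x₀ x₁ x₂ : Point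
    x₀ = (c , a)
    x₁ = (c + unit h , a)
    x₂ = (c + unit h + unit h , a)

  rowRun-edge : RowRun (x₀ ∷ x₁ ∷ []) a h c
  rowRun-edge = record
    { end = c + unit h
    ; start<end = i<[s]i+unit h c
    ; endOrBend-end = inj₁ refl
    ; endOrBend-unique = λ { _ _ (inj₁ refl) → refl ; _ _ (inj₂ (_ , _ , there (there ()) , _)) }
    ; covers = λ c' c≤c' c'<end → subst (λ k → Consec (x₀ ∷ x₁ ∷ []) (k , a) (k + unit h , a))
                                       (sym (≤[]∧<[]+unit⇒≡ h c≤c' c'<end)) here
    ; rowEdge = λ { here _ _ → ≤[]-refl h , i<[s]i+unit h c , refl ; (there (there ())) }
    ; verticalEdge = λ { here c≡c+h → ⊥-elim (i≢i+unit h c c≡c+h) ; (there (there ())) }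
    }

  rowRun-straight : ∀ {rest} → isBend x₀ x₁ x₂ ≡ false
                  → RowRun (x₁ ∷ x₂ ∷ rest) a h (c + unit h)
                  → RowRun (x₀ ∷ x₁ ∷ x₂ ∷ rest) a h c
  rowRun-straight {rest} straight R = record
    { end = end
    ; start<end = <[]-trans h (i<[s]i+unit h c) start<end
    ; endOrBend-end = Data.Sum.map₂ bendsAt-there endOrBend-end
    ; endOrBend-unique = unique
    ; covers = covers′
    ; rowEdge = rowEdge′
    ; verticalEdge = vertical
    }
    where
    open RowRun R
    L : List Point
    L = x₀ ∷ x₁ ∷ x₂ ∷ rest
    bendsAt-there : ∀ {γ} → BendsAt (x₁ ∷ x₂ ∷ rest) γ → BendsAt L γ
    bendsAt-there (p , r , t , b) = p , r , there t , b
    unique : ∀ γ → row γ ≡ a → EndOrBend L γ → γ ≡ (end , a)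
    unique γ r (inj₁ l) = endOrBend-unique γ r (inj₁ l)
    unique γ r (inj₂ (_ , _ , here , b)) = ⊥-elim (subst T straight b)
    unique γ r (inj₂ (p , q , there t , b)) = endOrBend-unique γ r (inj₂ (p , q , t , b))
    covers′ : ∀ c' → c ≤[ h ] c' → c' <[ h ] end → Consec L (c' , a) (c' + unit h , a)
    covers′ c' c≤c' c'<end with ≤[]⇒≡⊎+unit≤[] h c≤c'
    ... | inj₁ refl = here
    ... | inj₂ c+h≤c' = there (covers c' c+h≤c' c'<end)
    rowEdge′ : ∀ {p q} → Consec L p q → row p ≡ a → row q ≡ a
             → c ≤[ h ] col p × col p <[ h ] end × col q ≡ col p + unit h
    rowEdge′ here _ _ = ≤[]-refl h , <[]-trans h (i<[s]i+unit h c) start<end , refl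
    rowEdge′ (there e) rp rq with rowEdge e rp rq
    ... | c+h≤p , p<end , q≡p+h = +unit≤[]⇒≤[] h c+h≤p , p<end , q≡p+h
    vertical : VerticalEdgesBend L a
    vertical here c≡c+h = ⊥-elim (i≢i+unit h c c≡c+h)
    vertical (there e) cp≡cq with verticalEdge e cp≡cq
    ... | d , ap , aq , (p , r , t , b , v) = d , ap , aq , (p , r , there t , b , v)

  rowRun-turn : ∀ d {rest} → isBend x₀ x₁ (c + unit h , a + unit d) ≡ true
              → All (λ p → a <[ d ] row p) ((c + unit h , a + unit d) ∷ rest)
              → (∀ {p q} → Consec (x₁ ∷ (c + unit h , a + unit d) ∷ rest) p q → col p ≡ col q → col p ≡ c + unit h)
              → RowRun (x₀ ∷ x₁ ∷ (c + unit h , a + unit d) ∷ rest) a h c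
  rowRun-turn d {rest} turn beyond column = record
    { end = c + unit h
    ; start<end = i<[s]i+unit h c
    ; endOrBend-end = inj₂ (x₀ , z , here , subst T (sym turn) _)
    ; endOrBend-unique = unique
    ; covers = λ c' c≤c' c'<end → subst (λ k → Consec L (k , a) (k + unit h , a))
                                       (sym (≤[]∧<[]+unit⇒≡ h c≤c' c'<end)) here
    ; rowEdge = rowEdge
    ; verticalEdge = vertical
    }
    where
    z : Point
    z = (c + unit h , a + unit d)
    L : List Point
    L = x₀ ∷ x₁ ∷ z ∷ rest
    notOnRow : ∀ p → a <[ d ] row p → row p ≢ a
    notOnRow _ a<p p≡a = <[]-irrefl d (subst (a <[ d ]_) p≡a a<p)
    middleBeyond : ∀ {p γ r} → Triple (x₁ ∷ z ∷ rest) p γ r → a <[ d ] row γ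
    middleBeyond here = All.head beyond
    middleBeyond (there t) = All-Triple beyond t
    targetBeyond : ∀ {p q} → Consec (x₁ ∷ z ∷ rest) p q → a <[ d ] row q
    targetBeyond here = All.head beyond
    targetBeyond (there e) = proj₂ (All-Consec beyond e)
    unique : ∀ γ → row γ ≡ a → EndOrBend L γ → γ ≡ (c + unit h , a)
    unique γ r (inj₁ l) = ⊥-elim (notOnRow γ (All-last beyond l) r)
    unique γ r (inj₂ (_ , _ , here , _)) = refl
    unique γ r (inj₂ (_ , _ , there t , _)) = ⊥-elim (notOnRow γ (middleBeyond t) r)
    rowEdge : ∀ {p q} → Consec L p q → row p ≡ a → row q ≡ a
            → c ≤[ h ] col p × col p <[ h ] c + unit h × col q ≡ col p + unit h
    rowEdge here _ _ = ≤[]-refl h , i<[s]i+unit h c , refl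
    rowEdge {q = q} (there e) _ rq = ⊥-elim (notOnRow q (targetBeyond e) rq)
    weakBeyond : All (λ p → a ≤[ d ] row p) (x₁ ∷ z ∷ rest)
    weakBeyond = ≤[]-refl d ∷ All.map (<[]⇒≤[] d) beyond
    vertical : VerticalEdgesBend L a
    vertical here c≡c+h = ⊥-elim (i≢i+unit h c c≡c+h)
    vertical (there e) cp≡cq with All-Consec weakBeyond e
    ... | ap , aq = d , ap , aq , subst (λ k → BendType L (k , a) d) (sym (column e cp≡cq))
                                        (x₀ , z , here , subst T (sym turn) _ , inj₂ refl)

rowRun : ∀ a h c {rest} → Steps ((c , a) ∷ (c + unit h , a) ∷ rest) → NoBacktrack ((c , a) ∷ (c + unit h , a) ∷ rest)
       → bends ((c , a) ∷ (c + unit h , a) ∷ rest) ℕ.≤ 2 → RowRun ((c , a) ∷ (c + unit h , a) ∷ rest) a h c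
rowRun a h c {[]} _ _ _ = rowRun-edge h c
rowRun a h c {z ∷ rest} st nb bnd with isBend (c , a) (c + unit h , a) z in eb
... | false
  with straightOnRow h (st (there here)) (horizontal-next (c , a) (c + unit h , a) z eb (horizontal-rowStep h c a))
                     (nb here ∘ sym)
...   | refl = rowRun-straight h c eb (rowRun a h (c + unit h) (st ∘ there) (nb ∘ there) bnd)
rowRun a h c {z ∷ rest} st nb bnd | true
  with columnStep {c + unit h} {a} {z} (st (there here))
         (horizontal-false {c + unit h , a} {z} (horizontal-next (c , a) (c + unit h , a) z eb (horizontal-rowStep h c a)))
... | d , refl with leaveRow d (c + unit h) a (st ∘ there) (nb ∘ there) (≤[]-refl d) (ℕ.s≤s⁻¹ bnd)
...   | beyond , column = rowRun-turn h c d eb beyond column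

module _ {L : List Point} {a : ℤ} where

  rightRun-rowEdge : ∀ {start c} (R : RowRun L a Sign.+ start) → HasRowEdge L a c
                   → start ≤ c × c + 1ℤ ≤ RowRun.end R
  rightRun-rowEdge R (inj₁ e) with RowRun.rowEdge R e refl refl
  ... | start≤c , c<end , _ = start≤c , <⇒+1≤ c<end
  rightRun-rowEdge {c = c} R (inj₂ e) with RowRun.rowEdge R e refl refl
  ... | _ , _ , c≡c+1+1 = ⊥-elim (ℤP.<-irrefl c≡c+1+1 (ℤP.<-trans (i<[s]i+unit Sign.+ c) (i<[s]i+unit Sign.+ (c + 1ℤ))))

  leftRun-rowEdge : ∀ {start c} (R : RowRun L a Sign.- start) → HasRowEdge L a c
                  → RowRun.end R ≤ c × c + 1ℤ ≤ start
  leftRun-rowEdge {c = c} R (inj₁ e) with RowRun.rowEdge R e refl refl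
  ... | _ , _ , c+1≡c-1 = ⊥-elim (ℤP.<-irrefl (sym c+1≡c-1) (ℤP.<-trans (i<[s]i+unit Sign.- c) (i<[s]i+unit Sign.+ c)))
  leftRun-rowEdge R (inj₂ e) with RowRun.rowEdge R e refl refl
  ... | c+1≤start , end<c+1 , _ = <+1⇒≤ end<c+1 , c+1≤start

record RowSegment (P : List Point) (a : ℤ) : Set where
  field
    left right : ℤ
    left<right : left < right
    extremity-left : Extremity P a (left , a)
    extremity-right : Extremity P a (right , a)
    extremity-unique : ∀ γ → Extremity P a γ → γ ≡ (left , a) ⊎ γ ≡ (right , a)
    rowEdge⇒inside : ∀ {c} → HasRowEdge P a c → ContainsEdge left right c
    inside⇒rowEdge : ∀ {c} → ContainsEdge left right c → HasRowEdge P a c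
    verticalEdge : VerticalEdgesBend P a

segmentFromRuns : ∀ {P F B a c₀ c₁} → c₁ ≡ c₀ + 1ℤ
                → RowRun F a Sign.+ c₀ → RowRun B a Sign.- c₁ → SubWalk F P → SubWalk B P
                → (∀ {p q} → Consec P p q → Edge F p q ⊎ Edge B p q)
                → (∀ {γ} → StopsAt P γ ⊎ BendsAt P γ → EndOrBend F γ ⊎ EndOrBend B γ)
                → RowSegment P a
segmentFromRuns {P} {F} {B} {a} {c₀} refl R Lf sF sB edges extremities = record
  { left = Lf.end
  ; right = R.end
  ; left<right = ℤP.≤-<-trans left≤c₀ R.start<end
  ; extremity-left = refl , SubWalk.endOrBend sB Lf.endOrBend-end
  ; extremity-right = refl , SubWalk.endOrBend sF R.endOrBend-end
  ; extremity-unique = unique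
  ; rowEdge⇒inside = inside
  ; inside⇒rowEdge = rowEdge
  ; verticalEdge = vertical
  }
  where
  module R = RowRun R
  module Lf = RowRun Lf
  left≤c₀ : Lf.end ≤ c₀
  left≤c₀ = <+1⇒≤ Lf.start<end
  unique : ∀ γ → Extremity P a γ → γ ≡ (Lf.end , a) ⊎ γ ≡ (R.end , a)
  unique γ (rγ , e) with extremities e
  ... | inj₁ f = inj₂ (R.endOrBend-unique γ rγ f)
  ... | inj₂ b = inj₁ (Lf.endOrBend-unique γ rγ b)
  edges′ : ∀ {p q} → Edge P p q → Edge F p q ⊎ Edge B p q
  edges′ (inj₁ e) = edges e
  edges′ (inj₂ e) = Data.Sum.map Data.Sum.swap Data.Sum.swap (edges e)
  inside : ∀ {c} → HasRowEdge P a c → ContainsEdge Lf.end R.end c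
  inside e with edges′ e
  ... | inj₁ f with rightRun-rowEdge R f
  ...   | c₀≤c , c+1≤right = ℤP.≤-trans left≤c₀ c₀≤c , c+1≤right
  inside e | inj₂ b with leftRun-rowEdge Lf b
  ...   | left≤c , c+1≤c₀+1 = left≤c , ℤP.≤-trans c+1≤c₀+1 (<⇒+1≤ R.start<end)
  rowEdge : ∀ {c} → ContainsEdge Lf.end R.end c → HasRowEdge P a c
  rowEdge {c} (left≤c , c+1≤right) with c₀ ℤP.≤? c
  ... | yes c₀≤c = SubWalk.consec sF (R.covers c c₀≤c (+1≤⇒< c+1≤right))
  ... | no c₀≰c = Data.Sum.swap (SubWalk.consec sB (subst (λ k → Consec B (c + 1ℤ , a) (k , a))
                                                        (i+unit-opposite Sign.+ c) (Lf.covers (c + 1ℤ) c+1≤c₀+1 left<c+1)))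
    where
    c+1≤c₀+1 : c + 1ℤ ≤ c₀ + 1ℤ
    c+1≤c₀+1 = ℤP.≤-trans (<⇒+1≤ (ℤP.≰⇒> c₀≰c)) (ℤP.<⇒≤ (i<[s]i+unit Sign.+ c₀))
    left<c+1 : Lf.end < c + 1ℤ
    left<c+1 = ℤP.≤-<-trans left≤c (i<[s]i+unit Sign.+ c)
  vertical : VerticalEdgesBend P a
  vertical e cp≡cq with edges e
  ... | inj₁ f with VerticalEdgesBend-Edge R.verticalEdge f cp≡cq
  ...   | d , ap , aq , bend = d , ap , aq , SubWalk.bendType sF bend
  vertical e cp≡cq | inj₂ b with VerticalEdgesBend-Edge Lf.verticalEdge b cp≡cq
  ...   | d , ap , aq , bend = d , ap , aq , SubWalk.bendType sB bend

module Halves (pre : List Point) (p₀ q₀ : Point) (post : List Point) where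

  P F B : List Point
  P = pre ++ p₀ ∷ q₀ ∷ post
  F = p₀ ∷ q₀ ∷ post
  B = q₀ ∷ p₀ ∷ reverse pre

  reverse-P : reverse P ≡ reverse post ++ B
  reverse-P = reverse-++-++ pre (p₀ ∷ q₀ ∷ []) post

  reverse-front : reverse (pre ++ p₀ ∷ q₀ ∷ []) ≡ B
  reverse-front = ListP.reverse-++ pre (p₀ ∷ q₀ ∷ [])

  subWalk-F : SubWalk F P
  subWalk-F = SubWalk-++ʳ pre

  subWalk-B : SubWalk B P
  subWalk-B = SubWalk-reverse (subst (SubWalk B) (sym reverse-P) (SubWalk-++ʳ (reverse post)))

  edges : ∀ {p q} → Consec P p q → Edge F p q ⊎ Edge B p q
  edges e with Consec-++⁻ pre e
  ... | inj₁ f = inj₁ (inj₁ f)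
  ... | inj₂ b = inj₂ (inj₂ (there (subst (λ X → Consec X _ _) (ListP.reverse-++ pre (p₀ ∷ [])) (Consec-reverse b))))

  last-B : last B ≡ head P
  last-B = begin
    last B                                  ≡⟨ cong last (sym reverse-front) ⟩
    last (reverse (pre ++ p₀ ∷ q₀ ∷ []))    ≡⟨ last-reverse (pre ++ p₀ ∷ q₀ ∷ []) ⟩
    head (pre ++ p₀ ∷ q₀ ∷ [])              ≡⟨ head-++ pre ⟩
    head P                                  ∎
    where open ≡-Reasoning

  extremities : ∀ {γ} → StopsAt P γ ⊎ BendsAt P γ → EndOrBend F γ ⊎ EndOrBend B γ
  extremities (inj₁ (inj₁ h)) = inj₂ (inj₁ (trans last-B h))
  extremities (inj₁ (inj₂ l)) = inj₁ (inj₁ (trans (sym (last-++ pre)) l))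
  extremities {γ} (inj₂ (p , r , t , b)) with Triple-++⁻ pre t
  ... | inj₁ f = inj₁ (inj₂ (p , r , f , b))
  ... | inj₂ b′ = inj₂ (inj₂ (r , p , subst (λ X → Triple X _ _ _) reverse-front (Triple-reverse b′)
                               , subst T (isBend-sym p γ r) b))

rowRunFrom : ∀ {a h p q rest} → row p ≡ a → row q ≡ a → col q ≡ col p + unit h
           → Steps (p ∷ q ∷ rest) → NoBacktrack (p ∷ q ∷ rest) → bends (p ∷ q ∷ rest) ℕ.≤ 2
           → RowRun (p ∷ q ∷ rest) a h (col p)
rowRunFrom {a} {h} {c , _} {_ , _} refl refl refl = rowRun a h c

rowSegment : ∀ {P a} → IsGridPath P → bends P ℕ.≤ 2 → InIndex P a → RowSegment P a
rowSegment {a = a} (linked , unique) bnd (p₀ , q₀ , e , rp , rq) with Consec-split e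
... | pre , post , refl = fromDirection (horizontalStep {p₀} {q₀} (Linked⇒Steps linked e) (trans rp (sym rq)))
  where
  open Halves pre p₀ q₀ post
  steps : Steps P
  steps = Linked⇒Steps linked
  noBacktrack : NoBacktrack P
  noBacktrack = Unique⇒noBacktrack unique
  bends-F : bends F ℕ.≤ 2
  bends-F = ℕP.≤-trans (bends-++ʳ pre F) bnd
  bends-B : bends B ℕ.≤ 2
  bends-B = ℕP.≤-trans (bends-++ʳ (reverse post) B)
                       (subst (ℕ._≤ 2) (trans (sym (bends-reverse P)) (cong bends reverse-P)) bnd)
  run-F : ∀ h → col q₀ ≡ col p₀ + unit h → RowRun F a h (col p₀)
  run-F h cq = rowRunFrom rp rq cq (SubWalk.steps subWalk-F steps) (SubWalk.noBacktrack subWalk-F noBacktrack) bends-F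
  run-B : ∀ h → col p₀ ≡ col q₀ + unit h → RowRun B a h (col q₀)
  run-B h cp = rowRunFrom rq rp cp (SubWalk.steps subWalk-B steps) (SubWalk.noBacktrack subWalk-B noBacktrack) bends-B
  fromDirection : (∃[ s ] col q₀ ≡ col p₀ + unit s) → RowSegment P a
  fromDirection (Sign.+ , cq) =
    segmentFromRuns cq (run-F _ cq) (run-B _ (stepBack cq)) subWalk-F subWalk-B edges extremities
  fromDirection (Sign.- , cq) =
    segmentFromRuns (stepBack cq) (run-B _ (stepBack cq)) (run-F _ cq)
                    subWalk-B subWalk-F (Data.Sum.swap ∘ edges) (Data.Sum.swap ∘ extremities)

-- Types of extremities and t-projections

BendsAt⇒BendType : ∀ {L γ} → Steps L → BendsAt L γ → ∃[ d ] BendType L γ d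
BendsAt⇒BendType {γ = γ} st (p , r , t , b) = bySide (horizontal p γ) refl
  where
  bySide : ∀ h → horizontal p γ ≡ h → ∃[ d ] BendType _ γ d
  bySide false hp with verticalStep {γ} {p} (GridAdj-sym {p} {γ} (st (Triple⇒Consec₁ t)))
                                   (horizontal-false {γ} {p} (trans (horizontal-sym γ p) hp))
  ... | _ , d , rp = d , p , r , t , b , inj₁ rp
  bySide true hp with verticalStep {γ} {r} (st (Triple⇒Consec₂ t))
                                  (horizontal-false {γ} {r} (horizontal-next p γ r (Equivalence.to T-≡ b) hp))
  ... | _ , d , rr = d , p , r , t , b , inj₂ rr

extremityType : ∀ {L γ} → Steps L → StopsAt L γ ⊎ BendsAt L γ → ∃[ x ] HasType L γ x
extremityType _ (inj₁ stop) = ∅ , stop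
extremityType st (inj₂ bend) with BendsAt⇒BendType st bend
... | d , bt = bendTy d , Equivalence.to (BendType⇔HasType d) bt

BendType⇒Edge : ∀ {L g d} → Steps L → BendType L g d → Edge L g (col g , row g + unit d)
BendType⇒Edge {L} {g} {d} st (p , _ , t , _ , inj₁ rp) =
  inj₂ (subst (λ k → Consec L k g) (cong₂ _,_ cp rp) (Triple⇒Consec₁ t))
  where
  cp : col p ≡ col g
  cp = proj₁ (verticalStep {g} {p} (GridAdj-sym {p} {g} (st (Triple⇒Consec₁ t))) (λ e → i≢i+unit d (row g) (trans e rp)))
BendType⇒Edge {L} {g} {d} st (_ , r , t , _ , inj₂ rr) =
  inj₁ (subst (Consec L g) (cong₂ _,_ cr rr) (Triple⇒Consec₂ t))
  where
  cr : col r ≡ col g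
  cr = proj₁ (verticalStep {g} {r} (st (Triple⇒Consec₂ t)) (λ e → i≢i+unit d (row g) (trans e rr)))

-- a bend has only one vertical neighbour
¬BendType-both : ∀ {P γ} → Unique P → BendType P γ Sign.+ → BendType P γ Sign.- → ⊥
¬BendType-both {γ = γ} u (p , r , t , b , up) (_ , _ , t' , _ , down) with Triple-unique u t t'
... | refl , refl = sides up down
  where
  aboveBelow : ∀ {k} → k ≡ row γ + 1ℤ → k ≢ row γ + -1ℤ
  aboveBelow e e' = ℤP.<-irrefl (trans (sym e') e) (ℤP.<-trans (i<[s]i+unit Sign.- (row γ)) (i<[s]i+unit Sign.+ (row γ)))
  noBend : row p ≢ row γ → row γ ≢ row r → ⊥
  noBend p≢γ γ≢r = subst T (cong₂ _xor_ (horizontal-no {p} {γ} p≢γ) (horizontal-no {γ} {r} γ≢r)) b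
  sides : (row p ≡ row γ + 1ℤ ⊎ row r ≡ row γ + 1ℤ) → (row p ≡ row γ + -1ℤ ⊎ row r ≡ row γ + -1ℤ) → ⊥
  sides (inj₁ e) (inj₁ e') = aboveBelow e e'
  sides (inj₂ e) (inj₂ e') = aboveBelow e e'
  sides (inj₁ e) (inj₂ e') = noBend (λ p≡γ → i≢i+unit Sign.+ (row γ) (trans (sym p≡γ) e))
                                    (λ γ≡r → i≢i+unit Sign.- (row γ) (trans γ≡r e'))
  sides (inj₂ e) (inj₁ e') = noBend (λ p≡γ → i≢i+unit Sign.- (row γ) (trans (sym p≡γ) e'))
                                    (λ γ≡r → i≢i+unit Sign.+ (row γ) (trans γ≡r e))

HasType-unique : ∀ {P γ x d} → Unique P → HasType P γ x → BendType P γ d → x ≡ bendTy d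
HasType-unique {x = ∅} u stop (_ , _ , t , _) = ⊥-elim (StopsAt⇒¬Triple u stop t)
HasType-unique {x = ↑} {d = Sign.+} _ _ _ = refl
HasType-unique {x = ↓} {d = Sign.-} _ _ _ = refl
HasType-unique {x = ↑} {d = Sign.-} u up down = ⊥-elim (¬BendType-both u up down)
HasType-unique {x = ↓} {d = Sign.+} u down up = ⊥-elim (¬BendType-both u up down)

module _ {P a} (S : RowSegment P a) where
  open RowSegment S

  TProj-pinned : ∀ {t} → TProj P a t → α t ≡ left × β t ≡ right
  TProj-pinned (α<β , extα , extβ , _) with extremity-unique _ extα | extremity-unique _ extβ
  ... | inj₁ e | inj₂ e' = cong proj₁ e , cong proj₁ e'
  ... | inj₁ e | inj₁ e' = ⊥-elim (ℤP.<-irrefl (trans (cong proj₁ e) (sym (cong proj₁ e'))) α<β)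
  ... | inj₂ e | inj₂ e' = ⊥-elim (ℤP.<-irrefl (trans (cong proj₁ e) (sym (cong proj₁ e'))) α<β)
  ... | inj₂ e | inj₁ e' = ⊥-elim (ℤP.<-asym left<right (subst₂ _<_ (cong proj₁ e) (cong proj₁ e') α<β))

  TProj-exists : Steps P → ∃ (TProj P a)
  TProj-exists st with extremityType st (proj₂ extremity-left) | extremityType st (proj₂ extremity-right)
  ... | ty-left , has-left | ty-right , has-right =
    record { x = ty-left ; α = left ; y = ty-right ; β = right } ,
    left<right , extremity-left , extremity-right , extremity-unique , has-left , has-right

  TProj-rowEdge : ∀ {t c} → TProj P a t → ContainsEdge (α t) (β t) c → HasRowEdge P a c
  TProj-rowEdge tp inside with TProj-pinned tp
  ... | refl , refl = inside⇒rowEdge inside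

  TProj-inside : ∀ {t c} → TProj P a t → HasRowEdge P a c → ContainsEdge (α t) (β t) c
  TProj-inside tp e with TProj-pinned tp
  ... | refl , refl = rowEdge⇒inside e

TProj-endpointType : ∀ {P a t z γ} → TProj P a t → Endpoint t (z , γ) → HasType P (γ , a) z
TProj-endpointType (_ , _ , _ , _ , hx , _) (inj₁ refl) = hx
TProj-endpointType (_ , _ , _ , _ , _ , hy) (inj₂ refl) = hy

TProj-bendEndpoint : ∀ {P a t c d} → Unique P → TProj P a t → BendType P (c , a) d → Endpoint t (bendTy d , c)
TProj-bendEndpoint {a = a} {t} {c} u (_ , _ , _ , only , hx , hy) bt with only (c , a) (refl , inj₂ (BendType⇒BendsAt bt))
... | inj₁ refl = inj₁ (cong (_, α t) (sym (HasType-unique u hx bt)))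
... | inj₂ refl = inj₂ (cong (_, β t) (sym (HasType-unique u hy bt)))

-- Intersecting t-projections and common edges

nonEmptyType : ∀ {z} → z ≢ ∅ → ∃[ d ] z ≡ bendTy d
nonEmptyType {∅} z≢∅ = ⊥-elim (z≢∅ refl)
nonEmptyType {↓} _ = Sign.- , refl
nonEmptyType {↑} _ = Sign.+ , refl

module _ {P Q a} (SP : RowSegment P a) (SQ : RowSegment Q a) (stP : Steps P) (stQ : Steps Q)
         {t t'} (tp : TProj P a t) (tq : TProj Q a t') where

  commonEdge⇒SharesEdge : ∀ {c} → ContainsEdge (α t) (β t) c → ContainsEdge (α t') (β t') c → SharesEdge P Q
  commonEdge⇒SharesEdge inP inQ = Edge⇒SharesEdge (TProj-rowEdge SP tp inP) (TProj-rowEdge SQ tq inQ)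

  coherent⇒SharesEdge : ∀ {z γ} → Endpoint t' (z , γ) → Coherent t t' (z , γ) → SharesEdge P Q
  coherent⇒SharesEdge {γ = γ} (inj₁ refl) (inj₁ (α<γ , γ<β)) =
    commonEdge⇒SharesEdge {γ} (ℤP.<⇒≤ α<γ , <⇒+1≤ γ<β) (ℤP.≤-refl , <⇒+1≤ (proj₁ tq))
  coherent⇒SharesEdge {γ = γ} (inj₂ refl) (inj₁ (α<γ , γ<β)) =
    commonEdge⇒SharesEdge {γ + -1ℤ} (<⇒≤-1 α<γ , subst (_≤ β t) (sym (i-1+1≡i γ)) (ℤP.<⇒≤ γ<β))
                                     (<⇒≤-1 (proj₁ tq) , ℤP.≤-reflexive (i-1+1≡i γ))
  coherent⇒SharesEdge _ (inj₂ (inj₁ (_ , _ , inQ , _ , inP))) = commonEdge⇒SharesEdge inP inQ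
  coherent⇒SharesEdge e (inj₂ (inj₂ (z≢∅ , eP))) with nonEmptyType z≢∅
  ... | d , refl = Edge⇒SharesEdge (BendType⇒Edge stP (Equivalence.from (BendType⇔HasType d) (TProj-endpointType tp eP)))
                                   (BendType⇒Edge stQ (Equivalence.from (BendType⇔HasType d) (TProj-endpointType tq e)))

Intersect⇒SharesEdge : ∀ {P Q a t t'} → RowSegment P a → RowSegment Q a → Steps P → Steps Q
                     → TProj P a t → TProj Q a t' → Intersect t t' → SharesEdge P Q
Intersect⇒SharesEdge SP SQ stP stQ tp tq (inj₁ (_ , inP , inQ)) = commonEdge⇒SharesEdge SP SQ stP stQ tp tq inP inQ
Intersect⇒SharesEdge SP SQ stP stQ tp tq (inj₂ (inj₁ (_ , e , coh))) = coherent⇒SharesEdge SP SQ stP stQ tp tq e coh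
Intersect⇒SharesEdge SP SQ stP stQ tp tq (inj₂ (inj₂ (_ , e , coh))) =
  SharesEdge-sym (coherent⇒SharesEdge SQ SP stQ stP tq tp e coh)

rowEdgeColumn : ∀ {p q a} → GridAdj p q → row p ≡ a → row q ≡ a → ∃[ c ] (∀ {L} → Edge L p q → HasRowEdge L a c)
rowEdgeColumn {c , r} {c' , _} adj refl refl with horizontalStep {c , r} {c' , r} adj refl
... | Sign.+ , refl = c , id
... | Sign.- , refl = c + -1ℤ , λ {L} e → Data.Sum.swap (subst (λ k → Edge L (k , _) (c + -1ℤ , _)) (sym (i-1+1≡i c)) e)

horizontalEdge-onRow : ∀ {P Q a p q} → (∀ b → InIndex P b → InIndex Q b → b ≡ a)
                     → Consec P p q → Edge Q p q → row p ≡ row q → row p ≡ a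
horizontalEdge-onRow {p = p} {q} onlyA cP eQ rp≡rq = onlyA (row p) (p , q , cP , refl , sym rp≡rq) (inIndex eQ)
  where
  inIndex : Edge _ p q → InIndex _ (row p)
  inIndex (inj₁ c) = p , q , c , refl , sym rp≡rq
  inIndex (inj₂ c) = q , p , c , sym rp≡rq , refl

verticalEdge⇒Intersect : ∀ {P Q a t t' p q} → RowSegment P a → RowSegment Q a → Unique P → Unique Q
                       → TProj P a t → TProj Q a t' → Consec P p q → Edge Q p q
                       → col p ≡ col q → row p ≢ row q → Intersect t t'
verticalEdge⇒Intersect SP SQ uP uQ tp tq cP eQ cp≡cq rp≢rq
  with RowSegment.verticalEdge SP cP cp≡cq | VerticalEdgesBend-Edge (RowSegment.verticalEdge SQ) eQ cp≡cq
... | d , ap , aq , bendP | d' , ap' , aq' , bendQ with d' Sign.≟ d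
... | yes refl = inj₂ (inj₁ (_ , TProj-bendEndpoint uQ tq bendQ , inj₂ (inj₂ (bendTy≢∅ d , TProj-bendEndpoint uP tp bendP))))
... | no d'≢d = ⊥-elim (rp≢rq (trans (≤[]∧≤[]⇒≡ d'≢d ap ap') (sym (≤[]∧≤[]⇒≡ d'≢d aq aq'))))

SharesEdge⇒Intersect : ∀ {P Q a t t'} → RowSegment P a → RowSegment Q a → Steps P → Unique P → Unique Q
                     → (∀ b → InIndex P b → InIndex Q b → b ≡ a)
                     → SharesEdge P Q → TProj P a t → TProj Q a t' → Intersect t t'
SharesEdge⇒Intersect SP SQ stP uP uQ onlyA (p , q , cP , eQ) tp tq with row p ℤP.≟ row q
... | yes rp≡rq with horizontalEdge-onRow onlyA cP eQ rp≡rq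
...   | rp≡a with rowEdgeColumn (stP cP) rp≡a (trans (sym rp≡rq) rp≡a)
...     | c , rowEdge = inj₁ (c , TProj-inside SP tp (rowEdge (inj₁ cP)) , TProj-inside SQ tq (rowEdge eQ))
SharesEdge⇒Intersect SP SQ stP uP uQ onlyA (p , q , cP , eQ) tp tq | no rp≢rq =
  verticalEdge⇒Intersect SP SQ uP uQ tp tq cP eQ (sym (proj₁ (verticalStep {p} {q} (stP cP) rp≢rq))) rp≢rq

mainTheorem4 : ∀ {n} (G : Graph n) (R : B2Rep G) (a : ℤ) (u v : Fin n) → u ≢ v
    → InIndex (B2Rep.path R u) a → InIndex (B2Rep.path R v) a
    → (TProjIntersect (B2Rep.path R u) (B2Rep.path R v) a → Graph.Adj G u v)
    × ((∀ b → InIndex (B2Rep.path R u) b → InIndex (B2Rep.path R v) b → b ≡ a)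
       → (Graph.Adj G u v ⇔ TProjIntersect (B2Rep.path R u) (B2Rep.path R v) a))
mainTheorem4 G R a u v u≢v inU inV = intersect⇒adjacent , λ onlyA → mk⇔ (adjacent⇒intersect onlyA) intersect⇒adjacent
  where
  open B2Rep R
  SP : RowSegment (path u) a
  SP = rowSegment (isPath u) (twoBend u) inU
  SQ : RowSegment (path v) a
  SQ = rowSegment (isPath v) (twoBend v) inV
  stP : Steps (path u)
  stP = Linked⇒Steps (proj₁ (isPath u))
  stQ : Steps (path v)
  stQ = Linked⇒Steps (proj₁ (isPath v))
  intersect⇒adjacent : TProjIntersect (path u) (path v) a → Graph.Adj G u v
  intersect⇒adjacent I with TProj-exists SP stP | TProj-exists SQ stQ
  ... | t , tp | t' , tq = Equivalence.from (rep u v u≢v) (Intersect⇒SharesEdge SP SQ stP stQ tp tq (I t t' tp tq))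
  adjacent⇒intersect : (∀ b → InIndex (path u) b → InIndex (path v) b → b ≡ a)
                     → Graph.Adj G u v → TProjIntersect (path u) (path v) a
  adjacent⇒intersect onlyA adj _ _ =
    SharesEdge⇒Intersect SP SQ stP (proj₂ (isPath u)) (proj₂ (isPath v)) onlyA (Equivalence.to (rep u v u≢v) adj)
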